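{- Let $c \ge 2$ be an integer. If $G$ is a (finite, simple) graph with $\mathrm{mad}(G) < 4 - \frac{1}{c}$ and $\Delta(G) \ge 14c - 7$, then $\chi_\ell(G^2) \le 2\Delta(G)$.
   Context: For a graph $G$, $\Delta(G)$ is its maximum degree. The square $G^2$ of $G$ is the graph on $V(G)$ in which two distinct vertices are adjacent iff their distance in $G$ is at most $2$. The maximum average degree $\mathrm{mad}(G)$ is the maximum, over all subgraphs $H$ of $G$ with $V(H)\neq\emptyset$, of the average degree $2|E(H)|/|V(H)|$. The list chromatic number $\chi_\ell(G)$ is the least $k$ such that for every assignment of lists $L(v)$ with $|L(v)|\ge k$ to the vertices, there is a proper coloring $\phi$ of $G$ with $\phi(v)\in L(v)$ for all $v$. -}

module Defs where

open import Data.Bool using (Bool; true; false; _∧_; _∨_; not; if_then_else_)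
open import Data.Nat as ℕ using (ℕ; zero; suc; _+_; _*_; _⊔_; _≤_; _<_)
open import Data.Fin using (Fin; _<?_; _≟_)
open import Data.List using (List; map; foldr; allFin; length)
open import Data.Nat.ListAction using (sum)
open import Data.Bool.ListAction using (any)
open import Data.List.Membership.Propositional using (_∈_)
open import Data.List.Relation.Unary.Unique.Propositional using (Unique)
open import Data.Integer using (+_)
open import Data.Rational as ℚ using (ℚ; _/_; _-_)
open import Data.Product using (Σ; _×_)
open import Relation.Binary.PropositionalEquality using (_≡_; _≢_)
open import Relation.Nullary.Decidable using (⌊_⌋)

record Graph (n : ℕ) : Set where
  field
    adj   : Fin n → Fin n → Bool
    sym   : ∀ u v → adj u v ≡ adj v u
    irrefl : ∀ v → adj v v ≡ false
open Graph public

countV : {n : ℕ} → (Fin n → Bool) → ℕ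
countV {n} p = sum (map (λ u → if p u then 1 else 0) (allFin n))

deg : {n : ℕ} → Graph n → Fin n → ℕ
deg G v = countV (adj G v)

Δ : {n : ℕ} → Graph n → ℕ
Δ {n} G = foldr _⊔_ 0 (map (deg G) (allFin n))

VSet : ℕ → Set
VSet n = Fin n → Bool

edgesIn : {n : ℕ} → Graph n → VSet n → ℕ
edgesIn {n} G S =
  sum (map (λ u → countV (λ v → S u ∧ S v ∧ ⌊ u <? v ⌋ ∧ adj G u v)) (allFin n))

-- average degree 2|E(H)|/|V(H)| of the induced subgraph H = G[S]
-- (by convention 0 if S is empty; only used for nonempty S)
avgDeg : {n : ℕ} → Graph n → VSet n → ℚ
avgDeg G S with countV S
... | zero  = ℚ.0ℚ
... | suc k = (+ (2 * edgesIn G S)) / suc k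

-- mad(G) < r : every nonempty (induced) subgraph has average degree < r
-- (mad is a maximum over finitely many subgraphs, and the maximum is
--  attained on induced subgraphs)
madLess : {n : ℕ} → Graph n → ℚ → Set
madLess G r = ∀ S → 0 < countV S → avgDeg G S ℚ.< r

-- the rational 4 - 1/c  (c ≥ 1; value at c = 0 is irrelevant)
fourMinusInv : ℕ → ℚ
fourMinusInv zero    = + 4 / 1
fourMinusInv (suc k) = (+ 4 / 1) - (+ 1 / suc k)

sqAdj : {n : ℕ} → Graph n → Fin n → Fin n → Bool
sqAdj {n} G u v =
  not ⌊ u ≟ v ⌋ ∧ (adj G u v ∨ any (λ w → adj G u w ∧ adj G w v) (allFin n))

-- k-choosability of the graph with adjacency relation A on Fin n:
-- for every assignment of lists L(v) of at least k distinct colours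
-- there is a proper colouring φ with φ(v) ∈ L(v).
-- χ_ℓ ≤ k  is exactly  k-choosable.
Choosable : {n : ℕ} → (Fin n → Fin n → Bool) → ℕ → Set
Choosable {n} A k =
  (L : Fin n → List ℕ) →
  (∀ v → Unique (L v) × k ≤ length (L v)) →
  Σ (Fin n → ℕ) λ φ →
    (∀ v → φ v ∈ L v) × (∀ u v → A u v ≡ true → φ u ≢ φ v)

χℓSquare≤ : {n : ℕ} → Graph n → ℕ → Set
χℓSquare≤ G k = Choosable (sqAdj G) k

{-# OPTIONS --safe #-}
-- Write d(v) for the degree of v, D for Δ(G), and σ(v) for the sum of d over the neighbours of v;
-- σ(v) bounds the degree of v in G².
--
-- Reducibility.  After deleting an edge uv and colouring the rest by induction, only u and v can be
-- in conflict in G², so the colouring is repaired by recolouring them greedily if σ(u) ≤ 2D and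
-- σ(v) < 2D.  If d(v) = 1, it is enough to recolour v.
--
-- Discharging.  Assume that neither applies.  Call v high if d(v) ≥ 8c − 2 and rich if σ(v) > 2D.
-- Give v the charge 2c·d(v).  A high vertex gives 2c − 1 to each neighbour; a rich vertex that is
-- not high gives 2c − 1 to each neighbour of degree at most 2 and c to each neighbour of degree 3.
-- Then every non-isolated vertex ends with at least 8c − 2 = 2c(4 − 1/c), contradicting
-- mad(G) < 4 − 1/c on the set of non-isolated vertices.  The bound D ≥ 14c − 7 is used for the rich
-- vertices: many small neighbours are needed to make σ exceed 2D without enough large ones.
--
-- To avoid subtraction, c is written 2 + k and D is written 21 + 14k + e = 14c − 7 + e.
module Submission where

open import Defs
open import Data.Bool as Bool using (Bool; true; false; _∧_; _∨_; not; if_then_else_)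
open import Data.Bool.Properties using (∧-comm; ∨-comm; T-≡)
open import Data.Fin as Fin using (Fin)
import Data.Fin.Properties as Fin
open import Data.Integer as ℤ using (-[1+_]) renaming (+_ to pos)
import Data.Integer.Properties as ℤ
import Data.Integer.Tactic.RingSolver as ℤ-Solver
open import Data.List using (List; []; _∷_; map; filter; length; allFin; concatMap; foldr)
open import Data.List.Membership.Propositional using (_∈_; _∉_; lose; find)
open import Data.List.Membership.Propositional.Properties using (∈-filter⁺; ∈-filter⁻; ∈-concatMap⁺; ∈-map⁺; ∈-allFin)
open import Data.List.Properties using (length-++; length-map; filter-notAll)
import Data.List.Relation.Unary.All as All
open import Data.List.Relation.Unary.AllPairs using (_∷_)
open import Data.List.Relation.Unary.Any as Any using (here; there)
open import Data.List.Relation.Unary.Any.Properties using (any⁻)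
open import Data.List.Relation.Unary.Unique.Propositional using (Unique)
open import Data.Nat as ℕ using (suc; _+_; _<_; _⊔_; _≤?_; _<?_; z≤n; s≤s)
open import Data.Nat using (ℕ; _≤_; _*_; _∸_)
open import Data.Nat.ListAction using (sum)
open import Data.Nat.Properties
open import Data.Nat.Tactic.RingSolver using (solve-∀)
open import Data.Product using (∃; ∃₂; _×_; _,_; proj₁; proj₂)
open import Data.Rational as ℚ using (_/_; _-_)
import Data.Rational.Properties as ℚ
open import Data.Rational.Unnormalised as ℚᵘ using (mkℚᵘ; *<*)
import Data.Rational.Unnormalised.Properties as ℚᵘ
open import Data.Sum using (_⊎_; inj₁; inj₂)
open import Function using (_∘_; case_of_; Equivalence)
open import Relation.Binary.Definitions using (tri<; tri≈; tri>)
open import Relation.Binary.PropositionalEquality using (_≡_; _≢_; refl; trans; cong; cong₂; subst; subst₂; module ≡-Reasoning) renaming (sym to ≡-sym)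
open import Relation.Nullary using (¬_; ¬?; Dec; yes; no; contradiction; _×-dec_)
open import Relation.Nullary.Decidable using (⌊_⌋; dec-true; isYes≗does)
open import Relation.Unary using (Decidable)

-- Finite sums over lists

private variable
  A B : Set

∑ : List A → (A → ℕ) → ℕ
∑ xs f = sum (map f xs)

∑-mono : ∀ (xs : List A) {f g : A → ℕ} → (∀ {x} → x ∈ xs → f x ≤ g x) → ∑ xs f ≤ ∑ xs g
∑-mono []       f≤g = z≤n
∑-mono (x ∷ xs) f≤g = +-mono-≤ (f≤g (here refl)) (∑-mono xs λ x∈ → f≤g (there x∈))

∑-cong : ∀ (xs : List A) {f g : A → ℕ} → (∀ x → f x ≡ g x) → ∑ xs f ≡ ∑ xs g
∑-cong []       f≡g = refl
∑-cong (x ∷ xs) f≡g = cong₂ _+_ (f≡g x) (∑-cong xs f≡g)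

∑-+ : ∀ (xs : List A) (f g : A → ℕ) → ∑ xs (λ x → f x + g x) ≡ ∑ xs f + ∑ xs g
∑-+ []       f g = refl
∑-+ (x ∷ xs) f g = trans (cong (f x + g x +_) (∑-+ xs f g)) (interchange (f x) (g x) _ _)
  where
  interchange : ∀ a b c d → (a + b) + (c + d) ≡ (a + c) + (b + d)
  interchange = solve-∀

∑-* : ∀ (xs : List A) k (f : A → ℕ) → ∑ xs (λ x → k * f x) ≡ k * ∑ xs f
∑-* []       k f = ≡-sym (*-zeroʳ k)
∑-* (x ∷ xs) k f = trans (cong (k * f x +_) (∑-* xs k f)) (≡-sym (*-distribˡ-+ k (f x) _))

∑-const : ∀ (xs : List A) k → ∑ xs (λ _ → k) ≡ length xs * k
∑-const []       k = refl
∑-const (x ∷ xs) k = cong (k +_) (∑-const xs k)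

∑-zero : ∀ (xs : List A) → ∑ xs (λ _ → 0) ≡ 0
∑-zero xs = trans (∑-const xs 0) (*-zeroʳ (length xs))

∑-swap : ∀ (xs : List A) (ys : List B) (f : A → B → ℕ) →
         ∑ xs (λ x → ∑ ys (f x)) ≡ ∑ ys (λ y → ∑ xs (λ x → f x y))
∑-swap []       ys f = ≡-sym (∑-zero ys)
∑-swap (x ∷ xs) ys f = trans (cong (∑ ys (f x) +_) (∑-swap xs ys f)) (≡-sym (∑-+ ys (f x) _))

-- Only the term at `x` is singled out; all other terms are compared by `f ≤ g`. It serves for
-- strictness and for `σ` at a vertex that has one neighbour of small degree.
∑-gap : ∀ (xs : List A) {f g : A → ℕ} → (∀ {x} → x ∈ xs → f x ≤ g x) →
        ∀ {x} → x ∈ xs → ∑ xs f + g x ≤ ∑ xs g + f x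
∑-gap (y ∷ xs) {f} {g} f≤g (here refl) = begin
  f y + ∑ xs f + g y  ≡⟨ rotate (f y) _ _ ⟩
  g y + ∑ xs f + f y  ≤⟨ +-monoˡ-≤ (f y) (+-monoʳ-≤ (g y) (∑-mono xs λ x∈ → f≤g (there x∈))) ⟩
  g y + ∑ xs g + f y  ∎
  where
  open ≤-Reasoning
  rotate : ∀ a b c → a + b + c ≡ c + b + a
  rotate = solve-∀
∑-gap (y ∷ xs) {f} {g} f≤g {x} (there x∈) = begin
  f y + ∑ xs f + g x    ≡⟨ +-assoc (f y) _ _ ⟩
  f y + (∑ xs f + g x)  ≤⟨ +-mono-≤ (f≤g (here refl)) (∑-gap xs (λ x∈ → f≤g (there x∈)) x∈) ⟩
  g y + (∑ xs g + f x)  ≡⟨ +-assoc (g y) _ _ ⟨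
  g y + ∑ xs g + f x    ∎
  where open ≤-Reasoning

∑-strict : ∀ (xs : List A) {f g : A → ℕ} → (∀ {x} → x ∈ xs → f x ≤ g x) →
           ∀ {x} → x ∈ xs → f x < g x → ∑ xs f < ∑ xs g
∑-strict xs {f} {g} f≤g {x} x∈ fx<gx = +-cancelʳ-< (f x) _ _ (begin-strict
  ∑ xs f + f x  <⟨ +-monoʳ-< (∑ xs f) fx<gx ⟩
  ∑ xs f + g x  ≤⟨ ∑-gap xs f≤g x∈ ⟩
  ∑ xs g + f x  ∎)
  where open ≤-Reasoning

term≤∑ : ∀ {xs : List A} (f : A → ℕ) {x} → x ∈ xs → f x ≤ ∑ xs f
term≤∑ f (here refl) = m≤m+n _ _
term≤∑ f (there x∈)  = m≤n⇒m≤o+n _ (term≤∑ f x∈)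

∑-filter : ∀ (p : A → Bool) (P? : Decidable (λ x → p x ≡ true)) (xs : List A) (f : A → ℕ) →
           ∑ (filter P? xs) f ≡ ∑ xs (λ x → if p x then f x else 0)
∑-filter p P? []       f = refl
∑-filter p P? (x ∷ xs) f with P? x
... | yes px rewrite px = cong (f x +_) (∑-filter p P? xs f)
... | no ¬px with p x
...   | true  = contradiction refl ¬px
...   | false = ∑-filter p P? xs f

length≡∑ : ∀ (xs : List A) → length xs ≡ ∑ xs (λ _ → 1)
length≡∑ xs = trans (≡-sym (*-identityʳ _)) (≡-sym (∑-const xs 1))

length-concatMap≤ : ∀ (g : A → List B) (h : A → ℕ) xs → (∀ {x} → x ∈ xs → length (g x) ≤ h x) →
                    length (concatMap g xs) ≤ ∑ xs h
length-concatMap≤ g h []       g≤h = z≤n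
length-concatMap≤ g h (x ∷ xs) g≤h = ≤-trans (≤-reflexive (length-++ (g x)))
  (+-mono-≤ (g≤h (here refl)) (length-concatMap≤ g h xs λ x∈ → g≤h (there x∈)))

-- Choosing a colour outside a forbidden list

module _ {A : Set} (_≟_ : (x y : A) → Dec (x ≡ y)) where

  infixl 6 _without_
  _without_ : List A → A → List A
  xs without x = filter (λ y → ¬? (y ≟ x)) xs

  length-without : ∀ {xs x} → x ∈ xs → length (xs without x) < length xs
  length-without {xs} x∈ = filter-notAll (λ y → ¬? (y ≟ _)) xs (Any.map (λ x≡y y≢x → y≢x (≡-sym x≡y)) x∈)

  ∈-without : ∀ {xs x y} → y ∈ xs → y ≢ x → y ∈ xs without x
  ∈-without y∈ y≢x = ∈-filter⁺ (λ z → ¬? (z ≟ _)) y∈ y≢x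

  open import Data.List.Membership.DecPropositional _≟_ using (_∈?_)

  -- Pigeonhole. If the head `x` occurs in `ys`, all its copies are dropped from `ys` and the search
  -- goes on in the tail, which is still longer. Uniqueness of `xs` keeps the colour found there
  -- different from `x`.
  fresh : ∀ {xs : List A} → Unique xs → ∀ ys → length ys < length xs → ∃ λ x → x ∈ xs × x ∉ ys
  fresh {x ∷ xs} (x≢ ∷ xs!) ys (s≤s ys≤xs) with x ∈? ys
  ... | no x∉  = x , here refl , x∉
  ... | yes x∈ =
    let a , a∈ , a∉ = fresh xs! (ys without x) (<-≤-trans (length-without x∈) ys≤xs)
    in a , there a∈ , λ a∈ys → a∉ (∈-without a∈ys λ a≡x → All.lookup x≢ a∈ (≡-sym a≡x))

-- Derives a linear inequality from a hypothesis a ≤ b; the equation is then left to the ring solver.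
by-slack : ∀ s {a b x y} → a ≤ b → x + b + s ≡ y + a → x ≤ y
by-slack s {a} {b} {x} {y} a≤b eq = +-cancelʳ-≤ b x y (begin
  x + b      ≤⟨ m≤m+n _ s ⟩
  x + b + s  ≡⟨ eq ⟩
  y + a      ≤⟨ +-monoʳ-≤ y a≤b ⟩
  y + b      ∎)
  where open ≤-Reasoning

-- Conflicts in the square and greedy recolouring

module _ {n : ℕ} where

  _∖_ : List (Fin n) → Fin n → List (Fin n)
  _∖_ = _without_ Fin._≟_

  module _ (G : Graph n) where

    nbrs : Fin n → List (Fin n)
    nbrs v = filter (λ u → adj G v u Bool.≟ true) (allFin n)

    nbrDegSum : Fin n → ℕ
    nbrDegSum v = ∑ (nbrs v) (deg G)

    Conflict : Fin n → Fin n → Set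
    Conflict a b = a ≢ b × (adj G a b ≡ true ⊎ ∃ λ w → adj G a w ≡ true × adj G w b ≡ true)

    -- Partial colourings are total functions: a vertex outside `P` counts as uncoloured and its
    -- value is ignored.
    Proper : (Fin n → Set) → (Fin n → ℕ) → Set
    Proper P φ = ∀ {a b} → P a → P b → Conflict a b → φ a ≢ φ b

    -- Removing `v` from the neighbours of `u` makes room for `u` itself, so the block of `u` has
    -- length at most `deg G u`. Repetitions do no harm.
    reach₂ : Fin n → List (Fin n)
    reach₂ v = concatMap (λ u → u ∷ (nbrs u ∖ v)) (nbrs v)

    adj-flip : ∀ {u v} → adj G u v ≡ true → adj G v u ≡ true
    adj-flip {u} {v} = trans (sym G v u)

    ∈-nbrs⁺ : ∀ {u v} → adj G v u ≡ true → u ∈ nbrs v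
    ∈-nbrs⁺ {u} {v} vu = ∈-filter⁺ (λ u → adj G v u Bool.≟ true) (∈-allFin u) vu

    ∈-nbrs⁻ : ∀ {u v} → u ∈ nbrs v → adj G v u ≡ true
    ∈-nbrs⁻ {u} {v} u∈ = proj₂ (∈-filter⁻ (λ u → adj G v u Bool.≟ true) {xs = allFin n} u∈)

    ∑-nbrs : ∀ v (f : Fin n → ℕ) → ∑ (nbrs v) f ≡ ∑ (allFin n) (λ u → if adj G v u then f u else 0)
    ∑-nbrs v = ∑-filter (adj G v) _ (allFin n)

    length-nbrs : ∀ v → length (nbrs v) ≡ deg G v
    length-nbrs v = trans (length≡∑ (nbrs v)) (∑-nbrs v (λ _ → 1))

    length-reach₂ : ∀ v → length (reach₂ v) ≤ nbrDegSum v
    length-reach₂ v = length-concatMap≤ (λ u → u ∷ (nbrs u ∖ v)) (deg G) (nbrs v) λ {u} u∈ →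
      subst (length (nbrs u ∖ v) <_) (length-nbrs u)
        (length-without Fin._≟_ (∈-nbrs⁺ (adj-flip (∈-nbrs⁻ u∈))))

    conflict-sym : ∀ {a b} → Conflict a b → Conflict b a
    conflict-sym (a≢b , inj₁ ab)             = a≢b ∘ ≡-sym , inj₁ (adj-flip ab)
    conflict-sym (a≢b , inj₂ (w , aw , wb)) = a≢b ∘ ≡-sym , inj₂ (w , adj-flip wb , adj-flip aw)

    conflict⇒∈reach₂ : ∀ {v w} → Conflict v w → w ∈ reach₂ v
    conflict⇒∈reach₂ (_ , inj₁ vw) = ∈-concatMap⁺ _ (lose (∈-nbrs⁺ vw) (here refl))
    conflict⇒∈reach₂ (v≢w , inj₂ (u , vu , uw)) =
      ∈-concatMap⁺ _ (lose (∈-nbrs⁺ vu) (there (∈-without Fin._≟_ (∈-nbrs⁺ uw) (v≢w ∘ ≡-sym))))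

    sqAdj⇒conflict : ∀ {u v} → sqAdj G u v ≡ true → Conflict u v
    sqAdj⇒conflict {u} {v} uv with u Fin.≟ v
    ... | no u≢v with adj G u v
    ...   | true  = u≢v , inj₁ refl
    ...   | false with find (any⁻ _ (allFin n) (Equivalence.from T-≡ uv))
    ...     | w , _ , t with adj G u w in uw | adj G w v in wv
    ...       | true | true = u≢v , inj₂ (w , uw , wv)

    -- The predicate `w ≢ v → P w` is `P` with `v` added. Since `ys` covers the coloured vertices in
    -- conflict with `v`, avoiding the colours on `ys` is enough.
    recolour : ∀ {P} {φ} (L : Fin n → List ℕ) → (∀ w → φ w ∈ L w) → Proper P φ →
               ∀ v ys → (∀ {w} → P w → Conflict v w → w ∈ ys) →
               Unique (L v) → length ys < length (L v) →
               ∃ λ φ′ → (∀ w → φ′ w ∈ L w) × Proper (λ w → w ≢ v → P w) φ′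
    recolour {P} {φ} L φ∈L φ-proper v ys covers L! ys<L = φ′ , φ′∈L , φ′-proper
      where
      choice : ∃ λ a → a ∈ L v × a ∉ map φ ys
      choice = fresh ℕ._≟_ L! (map φ ys) (subst (_< length (L v)) (≡-sym (length-map φ ys)) ys<L)

      a = proj₁ choice

      a≢ : ∀ {w} → P w → Conflict v w → a ≢ φ w
      a≢ pw vw a≡φw = proj₂ (proj₂ choice)
        (subst (_∈ map φ ys) (≡-sym a≡φw) (∈-map⁺ φ (covers pw vw)))

      φ′ : Fin n → ℕ
      φ′ w = if ⌊ w Fin.≟ v ⌋ then a else φ w

      φ′∈L : ∀ w → φ′ w ∈ L w
      φ′∈L w with w Fin.≟ v
      ... | yes refl = proj₁ (proj₂ choice)
      ... | no  _    = φ∈L w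

      φ′-proper : Proper (λ w → w ≢ v → P w) φ′
      φ′-proper {x} {y} px py xy with x Fin.≟ v | y Fin.≟ v
      ... | yes refl | yes refl = contradiction refl (proj₁ xy)
      ... | yes refl | no y≢v   = a≢ (py y≢v) xy
      ... | no x≢v   | yes refl = a≢ (px x≢v) (conflict-sym xy) ∘ ≡-sym
      ... | no x≢v   | no y≢v   = φ-proper (px x≢v) (py y≢v) xy

    module _ (L : Fin n → List ℕ) {k : ℕ} (L-ok : ∀ w → Unique (L w) × k ≤ length (L w)) where

      extend-vertex : ∀ {φ v} → (∀ w → φ w ∈ L w) → nbrDegSum v < k → Proper (_≢ v) φ →
                      ∃ λ φ′ → (∀ w → φ′ w ∈ L w) × (∀ {a b} → Conflict a b → φ′ a ≢ φ′ b)
      extend-vertex {v = v} φ∈L dv<k φ-proper =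
        let φ′ , φ′∈L , φ′-proper = recolour L φ∈L φ-proper v (reach₂ v)
              (λ _ → conflict⇒∈reach₂) (proj₁ (L-ok v))
              (≤-<-trans (length-reach₂ v) (<-≤-trans dv<k (proj₂ (L-ok v))))
        in φ′ , φ′∈L , φ′-proper (λ a≢v → a≢v) (λ b≢v → b≢v)

      -- While u is recoloured, v counts as uncoloured, so u may have k conflicts rather than k ∸ 1.
      extend-edge : ∀ {φ u v} → (∀ w → φ w ∈ L w) → adj G u v ≡ true → nbrDegSum u ≤ k → nbrDegSum v < k →
                    Proper (λ w → w ≢ u × w ≢ v) φ →
                    ∃ λ φ′ → (∀ w → φ′ w ∈ L w) × (∀ {a b} → Conflict a b → φ′ a ≢ φ′ b)
      extend-edge {u = u} {v} φ∈L uv du≤k dv<k φ-proper =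
        let φ′ , φ′∈L , φ′-proper = recolour L φ∈L φ-proper u (reach₂ u ∖ v)
              (λ (_ , w≢v) uw → ∈-without Fin._≟_ (conflict⇒∈reach₂ uw) w≢v)
              (proj₁ (L-ok u))
              (<-≤-trans (length-without Fin._≟_ (conflict⇒∈reach₂ (u≢v , inj₁ uv)))
                 (≤-trans (length-reach₂ u) (≤-trans du≤k (proj₂ (L-ok u)))))
        in extend-vertex φ′∈L dv<k λ a≢v b≢v → φ′-proper (_, a≢v) (_, b≢v)
        where
        u≢v : u ≢ v
        u≢v refl with () ← trans (≡-sym uv) (irrefl G u)

  -- Deleting an edge

  is-pair : (u v a b : Fin n) → Bool
  is-pair u v a b = (⌊ a Fin.≟ u ⌋ ∧ ⌊ b Fin.≟ v ⌋) ∨ (⌊ a Fin.≟ v ⌋ ∧ ⌊ b Fin.≟ u ⌋)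

  is-pair-comm : ∀ u v a b → is-pair u v a b ≡ is-pair u v b a
  is-pair-comm u v a b = trans (∨-comm (⌊ a Fin.≟ u ⌋ ∧ ⌊ b Fin.≟ v ⌋) _)
    (cong₂ _∨_ (∧-comm ⌊ a Fin.≟ v ⌋ _) (∧-comm ⌊ a Fin.≟ u ⌋ _))

  delete : Graph n → Fin n → Fin n → Graph n
  delete G u v = record
    { adj    = λ a b → adj G a b ∧ not (is-pair u v a b)
    ; sym    = λ a b → cong₂ (λ x y → x ∧ not y) (sym G a b) (is-pair-comm u v a b)
    ; irrefl = λ a → cong (_∧ not (is-pair u v a a)) (irrefl G a)
    }

  module _ (G : Graph n) (u v : Fin n) where

    private G′ = delete G u v

    delete-⊇ : ∀ {a b} → adj G a b ≡ true → ¬ (a ≡ u × b ≡ v) → ¬ (a ≡ v × b ≡ u) → adj G′ a b ≡ true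
    delete-⊇ {a} {b} ab ¬uv ¬vu rewrite ab with a Fin.≟ u | b Fin.≟ v | a Fin.≟ v | b Fin.≟ u
    ... | yes p | yes q | _     | _     = contradiction (p , q) ¬uv
    ... | yes p | no q  | yes r | yes s = contradiction (r , s) ¬vu
    ... | yes p | no q  | yes r | no s  = refl
    ... | yes p | no q  | no r  | _     = refl
    ... | no p  | _     | yes r | yes s = contradiction (r , s) ¬vu
    ... | no p  | _     | yes r | no s  = refl
    ... | no p  | _     | no r  | _     = refl

    delete-uv : adj G′ u v ≡ false
    delete-uv with u Fin.≟ u | v Fin.≟ v
    ... | yes _ | yes _ with adj G u v
    ...   | true  = refl
    ...   | false = refl
    delete-uv | no u≢u | _ = contradiction refl u≢u
    delete-uv | yes _ | no v≢v = contradiction refl v≢v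

    adj-delete≤ : ∀ a b → (if adj G′ a b then 1 else 0) ≤ (if adj G a b then 1 else 0)
    adj-delete≤ a b with adj G a b
    ... | false = z≤n
    ... | true with is-pair u v a b
    ...   | true  = z≤n
    ...   | false = ≤-refl

    deg-delete≤ : ∀ a → deg G′ a ≤ deg G a
    deg-delete≤ a = ∑-mono (allFin n) λ {b} _ → adj-delete≤ a b

    edgesIn-delete≤ : ∀ S → edgesIn G′ S ≤ edgesIn G S
    edgesIn-delete≤ S = ∑-mono (allFin n) λ {a} _ → ∑-mono (allFin n) λ {b} _ → pointwise a b
      where
      pointwise : ∀ a b → (if S a ∧ S b ∧ ⌊ a Fin.<? b ⌋ ∧ adj G′ a b then 1 else 0)
                        ≤ (if S a ∧ S b ∧ ⌊ a Fin.<? b ⌋ ∧ adj G a b then 1 else 0)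
      pointwise a b with S a | S b | ⌊ a Fin.<? b ⌋
      ... | false | _     | _     = z≤n
      ... | true  | false | _     = z≤n
      ... | true  | true  | false = z≤n
      ... | true  | true  | true  = adj-delete≤ a b

    totalDeg-delete< : adj G u v ≡ true → ∑ (allFin n) (deg G′) < ∑ (allFin n) (deg G)
    totalDeg-delete< uv = ∑-strict (allFin n) (λ {a} _ → deg-delete≤ a) (∈-allFin u)
      (∑-strict (allFin n) (λ {b} _ → adj-delete≤ u b) (∈-allFin v) strict)
      where
      strict : (if adj G′ u v then 1 else 0) < (if adj G u v then 1 else 0)
      strict rewrite delete-uv | uv = s≤s z≤n

    -- Each edge of a path of length at most 2 contains an end of the path. A path through the edge
    -- `uv` therefore ends in `u` or `v`.
    delete-conflict : ∀ {a b} → a ≢ u × a ≢ v → b ≢ u × b ≢ v → Conflict G a b → Conflict G′ a b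
    delete-conflict (a≢u , a≢v) (b≢u , b≢v) (a≢b , inj₁ ab) =
      a≢b , inj₁ (delete-⊇ ab (a≢u ∘ proj₁) (a≢v ∘ proj₁))
    delete-conflict (a≢u , a≢v) (b≢u , b≢v) (a≢b , inj₂ (w , aw , wb)) =
      a≢b , inj₂ (w , delete-⊇ aw (a≢u ∘ proj₁) (a≢v ∘ proj₁) , delete-⊇ wb (b≢v ∘ proj₂) (b≢u ∘ proj₂))

    -- Here `a` or `b` may be `u`, so the path has to avoid `v`. As a middle vertex, `v` would need
    -- two different neighbours, but it has only `u`.
    delete-leaf-conflict : (∀ {b} → adj G v b ≡ true → b ≡ u) →
                           ∀ {a b} → a ≢ v → b ≢ v → Conflict G a b → Conflict G′ a b
    delete-leaf-conflict leaf a≢v b≢v (a≢b , inj₁ ab) =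
      a≢b , inj₁ (delete-⊇ ab (b≢v ∘ proj₂) (a≢v ∘ proj₁))
    delete-leaf-conflict leaf {a} {b} a≢v b≢v (a≢b , inj₂ (w , aw , wb)) =
      a≢b , inj₂ (w , delete-⊇ aw (w≢v ∘ proj₂) (a≢v ∘ proj₁) , delete-⊇ wb (b≢v ∘ proj₂) (w≢v ∘ proj₁))
      where
      w≢v : w ≢ v
      w≢v refl = a≢b (trans (leaf (adj-flip G aw)) (≡-sym (leaf wb)))

-- Auxiliary facts and the arithmetic of rich vertices

⌊⌋-true : ∀ {A : Set} (a? : Dec A) → A → ⌊ a? ⌋ ≡ true
⌊⌋-true a? a = trans (isYes≗does a?) (dec-true a? a)

indicator≤ : ∀ b {x} → (b ≡ true → 1 ≤ x) → (if b then 1 else 0) ≤ x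
indicator≤ true  1≤x = 1≤x refl
indicator≤ false 1≤x = z≤n

∑-empty : ∀ {A : Set} {xs : List A} (f : A → ℕ) → length xs ≡ 0 → ∑ xs f ≡ 0
∑-empty {xs = []} f _ = refl

-- h, m, s stand for the numbers of high and medium neighbours and for the charge kept on small ones.
rich-arith : ∀ k e h m s →
  suc (2 * (21 + 14 * k + e)) ≤ h * (21 + 14 * k + e) + m * (13 + 8 * k) + 2 * s →
  14 + 8 * k ≤ h * (7 + 4 * k) + m * (4 + 2 * k) + s
-- Two high neighbours, or one high and two medium, or four medium ones meet the demand by
-- themselves; the premise given to `by-slack` is just `0 ≤ 0`.
rich-arith k e (suc (suc h)) m s _ = by-slack _ (z≤n {0}) (eq k h m s)
  where
  eq : ∀ k h m s → 14 + 8 * k + 0 + (h * (7 + 4 * k) + m * (4 + 2 * k) + s)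
     ≡ (2 + h) * (7 + 4 * k) + m * (4 + 2 * k) + s + 0
  eq = solve-∀
rich-arith k e 1 (suc (suc m)) s _ = by-slack _ (z≤n {0}) (eq k m s)
  where
  eq : ∀ k m s → 14 + 8 * k + 0 + (1 + m * (4 + 2 * k) + s)
     ≡ 1 * (7 + 4 * k) + (2 + m) * (4 + 2 * k) + s + 0
  eq = solve-∀
rich-arith k e 0 (suc (suc (suc (suc m)))) s _ = by-slack _ (z≤n {0}) (eq k m s)
  where
  eq : ∀ k m s → 14 + 8 * k + 0 + (2 + m * (4 + 2 * k) + s)
     ≡ (4 + m) * (4 + 2 * k) + s + 0
  eq = solve-∀
-- With fewer large neighbours the hypothesis forces `s` to be large. It bounds `2 * s`, so the goal
-- is doubled.
rich-arith k e 1 0 s hyp = *-cancelˡ-≤ 2 (by-slack _ hyp (eq k e s))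
  where
  eq : ∀ k e s → 2 * (14 + 8 * k) + (1 * (21 + 14 * k + e) + 0 * (13 + 8 * k) + 2 * s) + (8 + 6 * k + e)
     ≡ 2 * (1 * (7 + 4 * k) + 0 * (4 + 2 * k) + s) + (1 + 2 * (21 + 14 * k + e))
  eq = solve-∀
rich-arith k e 1 1 s hyp = *-cancelˡ-≤ 2 (by-slack _ hyp (eq k e s))
  where
  eq : ∀ k e s → 2 * (14 + 8 * k) + (1 * (21 + 14 * k + e) + 1 * (13 + 8 * k) + 2 * s) + (3 + 2 * k + e)
     ≡ 2 * (1 * (7 + 4 * k) + 1 * (4 + 2 * k) + s) + (1 + 2 * (21 + 14 * k + e))
  eq = solve-∀
rich-arith k e 0 0 s hyp = *-cancelˡ-≤ 2 (by-slack _ hyp (eq k e s))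
  where
  eq : ∀ k e s → 2 * (14 + 8 * k) + (0 * (13 + 8 * k) + 2 * s) + (15 + 12 * k + 2 * e)
     ≡ 2 * (0 * (4 + 2 * k) + s) + (1 + 2 * (21 + 14 * k + e))
  eq = solve-∀
rich-arith k e 0 1 s hyp = *-cancelˡ-≤ 2 (by-slack _ hyp (eq k e s))
  where
  eq : ∀ k e s → 2 * (14 + 8 * k) + (1 * (13 + 8 * k) + 2 * s) + (10 + 8 * k + 2 * e)
     ≡ 2 * (1 * (4 + 2 * k) + s) + (1 + 2 * (21 + 14 * k + e))
  eq = solve-∀
rich-arith k e 0 2 s hyp = *-cancelˡ-≤ 2 (by-slack _ hyp (eq k e s))
  where
  eq : ∀ k e s → 2 * (14 + 8 * k) + (2 * (13 + 8 * k) + 2 * s) + (5 + 4 * k + 2 * e)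
     ≡ 2 * (2 * (4 + 2 * k) + s) + (1 + 2 * (21 + 14 * k + e))
  eq = solve-∀
-- The tight case: the slack is `2 * e`, which vanishes at D = 14c - 7.
rich-arith k e 0 3 s hyp = *-cancelˡ-≤ 2 (by-slack _ hyp (eq k e s))
  where
  eq : ∀ k e s → 2 * (14 + 8 * k) + (3 * (13 + 8 * k) + 2 * s) + 2 * e
     ≡ 2 * (3 * (4 + 2 * k) + s) + (1 + 2 * (21 + 14 * k + e))
  eq = solve-∀

-- Each element has its own certificate `h , m , s`, and certificates add up. `f` is the degree of a
-- neighbour, `g` the payment to it and `r` the charge available on that edge.
∑-classify : ∀ {A : Set} (D B p q : ℕ) (xs : List A) {f g r : A → ℕ} →
  (∀ {x} → x ∈ xs → ∃ λ h → ∃ λ m → ∃ λ s →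
     f x ≤ h * D + m * B + 2 * s × g x + (h * p + m * q + s) ≤ r x) →
  ∃ λ h → ∃ λ m → ∃ λ s →
     ∑ xs f ≤ h * D + m * B + 2 * s × ∑ xs g + (h * p + m * q + s) ≤ ∑ xs r
∑-classify D B p q []       cls = 0 , 0 , 0 , z≤n , z≤n
∑-classify D B p q (x ∷ xs) {f} {g} {r} cls =
  let h , m , s , f≤ , g≤ = cls (here refl)
      h′ , m′ , s′ , ∑f≤ , ∑g≤ = ∑-classify D B p q xs (λ x∈ → cls (there x∈))
  in h + h′ , m + m′ , s + s′
   , ≤-trans (+-mono-≤ f≤ ∑f≤) (≤-reflexive (eq₁ D B h m s h′ m′ s′))
   , ≤-trans (≤-reflexive (eq₂ p q (g x) (∑ xs g) h m s h′ m′ s′)) (+-mono-≤ g≤ ∑g≤)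
  where
  eq₁ : ∀ D B h m s h′ m′ s′ → (h * D + m * B + 2 * s) + (h′ * D + m′ * B + 2 * s′)
      ≡ (h + h′) * D + (m + m′) * B + 2 * (s + s′)
  eq₁ = solve-∀
  eq₂ : ∀ p q a b h m s h′ m′ s′ → (a + b) + ((h + h′) * p + (m + m′) * q + (s + s′))
      ≡ (a + (h * p + m * q + s)) + (b + (h′ * p + m′ * q + s′))
  eq₂ = solve-∀

-- Degree sum and edges on the set of non-isolated vertices

support : ∀ {n} → Graph n → VSet n
support G v = ⌊ 0 <? deg G v ⌋

module _ {n : ℕ} (G : Graph n) where

  deg>0 : ∀ {u v} → adj G u v ≡ true → 0 < deg G u
  deg>0 {u} {v} uv = ≤-trans (≤-reflexive (≡-sym one)) (term≤∑ _ (∈-allFin v))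
    where
    one : (if adj G u v then 1 else 0) ≡ 1
    one rewrite uv = refl

  support-adj : ∀ {u v} → adj G u v ≡ true → support G u ≡ true
  support-adj uv = ⌊⌋-true (0 <? _) (deg>0 uv)

  -- `edgesIn` counts an edge once, in increasing order of its ends, so an adjacent pair is covered
  -- by `up u v + up v u`. The support contains both ends of every edge, so no edge is lost.
  handshake : ∑ (allFin n) (deg G) ≤ 2 * edgesIn G (support G)
  handshake = begin
    ∑ V (deg G)                                        ≤⟨ ∑-mono V (λ {u} _ → ∑-mono V λ {v} _ → split u v) ⟩
    ∑ V (λ u → ∑ V (λ v → up u v + up v u))            ≡⟨ ∑-cong V (λ u → ∑-+ V (up u) (λ v → up v u)) ⟩
    ∑ V (λ u → ∑ V (up u) + ∑ V (λ v → up v u))        ≡⟨ ∑-+ V (λ u → ∑ V (up u)) _ ⟩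
    E + ∑ V (λ u → ∑ V (λ v → up v u))                 ≡⟨ cong (E +_) (∑-swap V V (λ u v → up v u)) ⟩
    E + E                                              ≡⟨ cong (E +_) (+-identityʳ E) ⟨
    2 * E                                              ∎
    where
    open ≤-Reasoning
    V = allFin n
    S = support G
    E = edgesIn G S
    up : Fin n → Fin n → ℕ
    up u v = if S u ∧ S v ∧ ⌊ u Fin.<? v ⌋ ∧ adj G u v then 1 else 0

    up-edge : ∀ {u v} → u Fin.< v → adj G u v ≡ true → 1 ≤ up u v
    up-edge {u} {v} u<v uv
      rewrite support-adj uv | support-adj (adj-flip G uv) | ⌊⌋-true (u Fin.<? v) u<v | uv = ≤-refl

    edge-split : ∀ {u v} → adj G u v ≡ true → 1 ≤ up u v + up v u
    edge-split {u} {v} uv with Fin.<-cmp u v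
    ... | tri< u<v _ _  = ≤-trans (up-edge u<v uv) (m≤m+n _ _)
    ... | tri> _ _ v<u  = ≤-trans (up-edge v<u (adj-flip G uv)) (m≤n+m _ _)
    ... | tri≈ _ refl _ with () ← trans (≡-sym uv) (irrefl G u)

    split : ∀ u v → (if adj G u v then 1 else 0) ≤ up u v + up v u
    split u v = indicator≤ (adj G u v) edge-split

-- Discharging

module Discharging {n : ℕ} (G : Graph n) (k e : ℕ) where

  private
    d = deg G
    -- In terms of c: `q` is 2c - 1 and `T` is 8c - 2. Below, `4 + 2 * k` is 2c, `13 + 8 * k` is 8c
    -- - 3 and `7 + 4 * k` is 4c - 1.
    D = 21 + 14 * k + e
    q = 3 + 2 * k
    T = 14 + 8 * k

  pay : ℕ → ℕ
  pay 0 = q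
  pay 1 = q
  pay 2 = q
  pay 3 = 2 + k
  pay (suc (suc (suc (suc _)))) = 0

  give : Fin n → Fin n → ℕ
  give u w = if ⌊ T ≤? d u ⌋ then q
             else if ⌊ 2 * D <? nbrDegSum G u ⌋ then pay (d w) else 0

  received : Fin n → ℕ
  received v = ∑ (nbrs G v) (λ u → give u v)

  given : Fin n → ℕ
  given v = ∑ (nbrs G v) (give v)

  give-high : ∀ {u} w → T ≤ d u → give u w ≡ q
  give-high {u} w high with T ≤? d u
  ... | yes _ = refl
  ... | no ¬h = contradiction high ¬h

  give-rich : ∀ {u} w → ¬ T ≤ d u → 2 * D < nbrDegSum G u → give u w ≡ pay (d w)
  give-rich {u} w ¬high rich with T ≤? d u | 2 * D <? nbrDegSum G u
  ... | yes h | _     = contradiction h ¬high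
  ... | no _  | yes _ = refl
  ... | no _  | no ¬r = contradiction rich ¬r

  give-poor : ∀ {u} w → ¬ T ≤ d u → ¬ 2 * D < nbrDegSum G u → give u w ≡ 0
  give-poor {u} w ¬high ¬rich with T ≤? d u | 2 * D <? nbrDegSum G u
  ... | yes h | _     = contradiction h ¬high
  ... | no _  | yes r = contradiction r ¬rich
  ... | no _  | no _  = refl

  ∑-nbrs-const : ∀ v x → ∑ (nbrs G v) (λ _ → x) ≡ d v * x
  ∑-nbrs-const v x = trans (∑-const (nbrs G v) x) (cong (_* x) (length-nbrs G v))

  -- Charge is only moved: both sides sum `give` over the ordered adjacent pairs, and symmetry of
  -- `adj` exchanges the roles.
  ∑given≡∑received : ∑ (allFin n) given ≡ ∑ (allFin n) received
  ∑given≡∑received = begin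
    ∑ V given                                                  ≡⟨ ∑-cong V (λ v → ∑-nbrs G v (give v)) ⟩
    ∑ V (λ v → ∑ V (λ u → if adj G v u then give v u else 0))  ≡⟨ ∑-swap V V _ ⟩
    ∑ V (λ u → ∑ V (λ v → if adj G v u then give v u else 0))  ≡⟨ ∑-cong V (λ u → ∑-cong V λ v → cong (if_then give v u else 0) (sym G v u)) ⟩
    ∑ V (λ u → ∑ V (λ v → if adj G u v then give v u else 0))  ≡⟨ ∑-cong V (λ u → ∑-nbrs G u (λ v → give v u)) ⟨
    ∑ V received                                               ∎
    where
    open ≡-Reasoning
    V = allFin n

  module _ (d≤D : ∀ v → d v ≤ D) (no-leaf : ∀ v → d v ≢ 1)
           (irreducible : ∀ {u v} → adj G u v ≡ true → nbrDegSum G v < 2 * D → 2 * D < nbrDegSum G u) where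

    Enough : Fin n → Set
    Enough v = T + given v ≤ (4 + 2 * k) * d v + received v

    -- Of the 2c per edge, 2c - 1 is given away. One unit per edge remains, hence at least `T` in
    -- all.
    enough-high : ∀ v → T ≤ d v → Enough v
    enough-high v high = begin
      T + given v                      ≡⟨ cong (T +_) (∑-cong (nbrs G v) λ w → give-high w high) ⟩
      T + ∑ (nbrs G v) (λ _ → q)       ≡⟨ cong (T +_) (∑-nbrs-const v q) ⟩
      T + d v * q                      ≤⟨ +-monoˡ-≤ (d v * q) high ⟩
      d v + d v * q                    ≡⟨ eq k (d v) ⟩
      (4 + 2 * k) * d v                ≤⟨ m≤m+n _ _ ⟩
      (4 + 2 * k) * d v + received v   ∎
      where
      open ≤-Reasoning
      eq : ∀ k x → x + x * (3 + 2 * k) ≡ (4 + 2 * k) * x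
      eq = solve-∀

    low : ∀ {u} → ¬ T ≤ d u → d u ≤ 13 + 8 * k
    low ¬high = ≤-pred (≰⇒> ¬high)

    received₂ : ∀ {v} → d v ≡ 2 → 2 * q ≤ received v
    received₂ {v} dv≡2 = begin
      2 * q                      ≡⟨ cong (_* q) dv≡2 ⟨
      d v * q                    ≡⟨ ∑-nbrs-const v q ⟨
      ∑ (nbrs G v) (λ _ → q)     ≤⟨ ∑-mono (nbrs G v) q≤give ⟩
      received v                 ∎
      where
      open ≤-Reasoning
      eq : ∀ k e x → 1 + x + (2 * (21 + 14 * k + e) + (13 + 8 * k)) + (7 + 6 * k + e)
         ≡ 2 * (21 + 14 * k + e) + (x + (21 + 14 * k + e))
      eq = solve-∀

      q≤give : ∀ {u} → u ∈ nbrs G v → q ≤ give u v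
      q≤give {u} u∈ = case T ≤? d u of λ where
            (yes high) → ≤-reflexive (≡-sym (give-high v high))
            (no ¬high) → ≤-reflexive (≡-sym (trans
              (give-rich v ¬high (irreducible (adj-flip G (∈-nbrs⁻ G u∈)) (light ¬high))) (cong pay dv≡2)))
        where
        -- One neighbour has degree at most 8c - 3 and the other at most D, so `σ(v)` is at most D +
        -- 8c - 3 < 2D. By irreducibility `u` is then rich and pays `q`.
        light : ¬ T ≤ d u → nbrDegSum G v < 2 * D
        light ¬high = by-slack _ (≤-trans (∑-gap (nbrs G v) {d} {λ _ → D} (λ _ → d≤D _) u∈)
                  (+-mono-≤ (≤-reflexive (trans (∑-nbrs-const v D) (cong (_* D) dv≡2))) (low ¬high)))
                  (eq k e (nbrDegSum G v))

    -- A single high neighbour gives 2c - 1, which suffices. Without one, `σ(v)` is at most 3(8c -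
    -- 3) < 2D, so all three neighbours are rich and give c each.
    received₃ : ∀ {v} → d v ≡ 3 → 2 + 2 * k ≤ received v
    received₃ {v} dv≡3 with Any.any? (λ u → T ≤? d u) (nbrs G v)
    ... | yes someHigh =
      let u , u∈ , high = find someHigh
      in ≤-trans (n≤1+n _) (≤-trans (≤-reflexive (≡-sym (give-high v high))) (term≤∑ (λ u → give u v) u∈))
    ... | no noHigh = begin
      2 + 2 * k                     ≤⟨ by-slack (4 + k) (z≤n {0}) (eq₁ k) ⟩
      3 * (2 + k)                   ≡⟨ cong (_* (2 + k)) dv≡3 ⟨
      d v * (2 + k)                 ≡⟨ ∑-nbrs-const v (2 + k) ⟨
      ∑ (nbrs G v) (λ _ → 2 + k)    ≤⟨ ∑-mono (nbrs G v) (λ u∈ → ≤-reflexive (≡-sym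
                                         (trans (give-rich v (¬high u∈) (irreducible (adj-flip G (∈-nbrs⁻ G u∈)) light))
                                                (cong pay dv≡3)))) ⟩
      received v                    ∎
      where
      open ≤-Reasoning
      eq₁ : ∀ k → 2 + 2 * k + 0 + (4 + k) ≡ 3 * (2 + k) + 0
      eq₁ = solve-∀
      eq₂ : ∀ k e x → 1 + x + 3 * (13 + 8 * k) + (2 + 4 * k + 2 * e) ≡ 2 * (21 + 14 * k + e) + x
      eq₂ = solve-∀
      ¬high : ∀ {u} → u ∈ nbrs G v → ¬ T ≤ d u
      ¬high u∈ high = noHigh (lose u∈ high)
      light : nbrDegSum G v < 2 * D
      light = by-slack _ (≤-trans (∑-mono (nbrs G v) (λ u∈ → low (¬high u∈)))
                (≤-reflexive (trans (∑-nbrs-const v (13 + 8 * k)) (cong (_* (13 + 8 * k)) dv≡3))))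
                (eq₂ k e (nbrDegSum G v))

    -- Such a vertex gives nothing. Degree 2 lacks 4c - 2 and degree 3 lacks 2c - 2, which the
    -- neighbours supply; from degree 4 on the initial charge is at least 8c.
    enough-poor : ∀ v → 0 < d v → ¬ T ≤ d v → ¬ 2 * D < nbrDegSum G v → Enough v
    enough-poor v 0<dv ¬high ¬rich = subst (_≤ (4 + 2 * k) * d v + received v) (≡-sym T+0) (keep (d v) refl)
      where
      T+0 : T + given v ≡ T
      T+0 = trans (cong (T +_) (trans (∑-cong (nbrs G v) λ w → give-poor w ¬high ¬rich) (∑-zero (nbrs G v)))) (+-identityʳ T)

      eq₂ : ∀ k → 14 + 8 * k ≡ (4 + 2 * k) * 2 + 2 * (3 + 2 * k)
      eq₂ = solve-∀
      eq₃ : ∀ k → 14 + 8 * k ≡ (4 + 2 * k) * 3 + (2 + 2 * k)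
      eq₃ = solve-∀
      eq₄ : ∀ k x → 14 + 8 * k + 0 + (2 + (4 + 2 * k) * x) ≡ (4 + 2 * k) * (4 + x) + 0
      eq₄ = solve-∀

      keep : ∀ x → d v ≡ x → T ≤ (4 + 2 * k) * x + received v
      keep 0 dv = contradiction dv (>⇒≢ 0<dv)
      keep 1 dv = contradiction dv (no-leaf v)
      keep 2 dv = ≤-trans (≤-reflexive (eq₂ k)) (+-monoʳ-≤ _ (received₂ dv))
      keep 3 dv = ≤-trans (≤-reflexive (eq₃ k)) (+-monoʳ-≤ _ (received₃ dv))
      keep (suc (suc (suc (suc x)))) dv = ≤-trans (by-slack _ (z≤n {0}) (eq₄ k x)) (m≤m+n _ _)

    -- For a rich `v` that is not high, the edge to `u` carries 2c of the charge of `v` plus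
    -- `give u v`, less the payment to `u`. This leaves 4c - 1 if `u` is high, and at least 2c if
    -- `u` has degree 4 to 8c - 3, c for degree 3 and 1 for degree at most 2. In the last two cases
    -- twice the remainder bounds the degree of `u`, whence `2 * s`.
    classify : ∀ u v → ∃ λ h → ∃ λ m → ∃ λ s →
               d u ≤ h * D + m * (13 + 8 * k) + 2 * s ×
               pay (d u) + (h * (7 + 4 * k) + m * (4 + 2 * k) + s) ≤ (4 + 2 * k) + give u v
    classify u v with T ≤? d u
    ... | yes high = 1 , 0 , 0
                   , ≤-trans (d≤D u) (≤-reflexive (eq₁ D))
                   , ≤-reflexive (trans (cong (_+ _) (pay-high (d u) high)) (eq₂ k))
      where
      eq₁ : ∀ x → x ≡ 1 * x + 0 + 0
      eq₁ = solve-∀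
      eq₂ : ∀ k → 1 * (7 + 4 * k) + 0 + 0 ≡ (4 + 2 * k) + (3 + 2 * k)
      eq₂ = solve-∀
      pay-high : ∀ x → T ≤ x → pay x ≡ 0
      pay-high (suc (suc (suc (suc x)))) _ = refl
      pay-high 1 (s≤s ())
      pay-high 2 (s≤s (s≤s ()))
      pay-high 3 (s≤s (s≤s (s≤s ())))
    ... | no ¬high =
      let h , m , s , d≤ , pay≤ = low-case (d u) (low ¬high)
      in h , m , s , d≤ , ≤-trans pay≤ (m≤m+n _ _)
      where
      low-case : ∀ x → x ≤ 13 + 8 * k → ∃ λ h → ∃ λ m → ∃ λ s →
                 x ≤ h * D + m * (13 + 8 * k) + 2 * s ×
                 pay x + (h * (7 + 4 * k) + m * (4 + 2 * k) + s) ≤ 4 + 2 * k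
      low-case 0 _ = 0 , 0 , 1 , z≤n , ≤-reflexive (+-comm q 1)
      low-case 1 _ = 0 , 0 , 1 , s≤s z≤n , ≤-reflexive (+-comm q 1)
      low-case 2 _ = 0 , 0 , 1 , ≤-refl , ≤-reflexive (+-comm q 1)
      low-case 3 _ = 0 , 0 , 2 + k , by-slack _ (z≤n {0}) (eq₁ k) , ≤-reflexive (eq₂ k)
        where
        eq₁ : ∀ k → 3 + 0 + (1 + 2 * k) ≡ 2 * (2 + k) + 0
        eq₁ = solve-∀
        eq₂ : ∀ k → 2 + k + (2 + k) ≡ 4 + 2 * k
        eq₂ = solve-∀
      low-case (suc (suc (suc (suc x)))) x≤ = 0 , 1 , 0
                   , ≤-trans x≤ (≤-reflexive (eq (13 + 8 * k)))
                   , ≤-reflexive (≡-sym (eq (4 + 2 * k)))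
        where
        eq : ∀ y → y ≡ 1 * y + 0
        eq = solve-∀

    -- The certificates of the neighbours are summed. Richness makes the total degree exceed 2D, and
    -- `rich-arith` turns this into a remainder of at least `T`.
    enough-rich : ∀ v → ¬ T ≤ d v → 2 * D < nbrDegSum G v → Enough v
    enough-rich v ¬high rich =
      let h , m , s , dsum≤ , pay≤ = ∑-classify D (13 + 8 * k) (7 + 4 * k) (4 + 2 * k) (nbrs G v)
                                       {r = λ u → (4 + 2 * k) + give u v} (λ {u} _ → classify u v)
      in begin
      T + given v                                            ≡⟨ +-comm T (given v) ⟩
      given v + T                                            ≡⟨ cong (_+ T) (∑-cong (nbrs G v) λ w → give-rich w ¬high rich) ⟩
      ∑ (nbrs G v) (λ u → pay (d u)) + T                     ≤⟨ +-monoʳ-≤ _ (rich-arith k e h m s (≤-trans rich dsum≤)) ⟩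
      _                                                      ≤⟨ pay≤ ⟩
      ∑ (nbrs G v) (λ u → (4 + 2 * k) + give u v)            ≡⟨ ∑-+ (nbrs G v) (λ _ → 4 + 2 * k) _ ⟩
      ∑ (nbrs G v) (λ _ → 4 + 2 * k) + received v            ≡⟨ cong (_+ received v) (∑-nbrs-const v (4 + 2 * k)) ⟩
      d v * (4 + 2 * k) + received v                         ≡⟨ cong (_+ received v) (*-comm (d v) (4 + 2 * k)) ⟩
      (4 + 2 * k) * d v + received v                         ∎
      where open ≤-Reasoning

    enough : ∀ v → 0 < d v → Enough v
    enough v 0<dv = case T ≤? d v of λ where
      (yes high) → enough-high v high
      (no ¬high) → case 2 * D <? nbrDegSum G v of λ where
        (yes rich) → enough-rich v ¬high rich
        (no ¬rich) → enough-poor v 0<dv ¬high ¬rich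

    -- `Enough` is summed over the non-isolated vertices and the moved charge cancels. Isolated
    -- vertices contribute 0 on the left, having no neighbours to give to.
    dense : T * countV (support G) ≤ (4 + 2 * k) * (2 * edgesIn G (support G))
    dense = ≤-trans (+-cancelʳ-≤ (∑ V received) _ _ (begin
      T * countV S + ∑ V received                     ≡⟨ cong₂ _+_ (∑-* V T one) ∑given≡∑received ⟨
      ∑ V (λ v → T * one v) + ∑ V given               ≡⟨ ∑-+ V (λ v → T * one v) given ⟨
      ∑ V (λ v → T * one v + given v)                 ≤⟨ ∑-mono V (λ {v} _ → pointwise v) ⟩
      ∑ V (λ v → (4 + 2 * k) * d v + received v)      ≡⟨ ∑-+ V (λ v → (4 + 2 * k) * d v) received ⟩
      ∑ V (λ v → (4 + 2 * k) * d v) + ∑ V received    ≡⟨ cong (_+ ∑ V received) (∑-* V (4 + 2 * k) d) ⟩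
      (4 + 2 * k) * ∑ V d + ∑ V received              ∎))
      (*-monoʳ-≤ (4 + 2 * k) (handshake G))
      where
      open ≤-Reasoning
      V = allFin n
      S = support G
      one : Fin n → ℕ
      one v = if S v then 1 else 0

      pointwise : ∀ v → T * one v + given v ≤ (4 + 2 * k) * d v + received v
      pointwise v with 0 <? d v
      ... | yes 0<dv = subst (λ x → x + given v ≤ (4 + 2 * k) * d v + received v) (≡-sym (*-identityʳ T)) (enough v 0<dv)
      ... | no  dv≯0 = ≤-trans (≤-reflexive (cong₂ _+_ (*-zeroʳ T)
              (∑-empty {xs = nbrs G v} (give v) (trans (length-nbrs G v) (n≤0⇒n≡0 (≮⇒≥ dv≯0)))))) z≤n

-- From rational average degrees to natural numbers

clear-denominators : ∀ a b j → (pos a / suc b) ℚ.< (pos 4 / 1) - (pos 1 / suc j) →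
                     suc j * a + suc b < 4 * suc j * suc b
clear-denominators a b j lt = ℤ.drop‿+<+ (subst₂ ℤ._<_ lhs rhs (ℤ.+-monoˡ-< (pos (suc b)) (cross ltᵘ)))
  where
  -- `_/_` on `ℚ` reduces fractions. Unnormalised rationals keep the denominators as written, so
  -- that cross-multiplication becomes explicit.
  ltᵘ : mkℚᵘ (pos a) b ℚᵘ.< mkℚᵘ (pos 4) 0 ℚᵘ.- mkℚᵘ (pos 1) j
  ltᵘ = ℚᵘ.<-respʳ-≃
    (ℚᵘ.≃-trans (ℚ.toℚᵘ-homo-+ (pos 4 / 1) (ℚ.- (pos 1 / suc j)))
      (ℚᵘ.+-cong (ℚ.toℚᵘ-fromℚᵘ (mkℚᵘ (pos 4) 0))
        (ℚᵘ.≃-trans (ℚ.toℚᵘ-homo‿- (pos 1 / suc j)) (ℚᵘ.-‿cong (ℚ.toℚᵘ-fromℚᵘ (mkℚᵘ (pos 1) j))))))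
    (ℚᵘ.<-respˡ-≃ (ℚ.toℚᵘ-fromℚᵘ (mkℚᵘ (pos a) b)) (ℚ.toℚᵘ-mono-< lt))

  cross : mkℚᵘ (pos a) b ℚᵘ.< mkℚᵘ (pos 4) 0 ℚᵘ.- mkℚᵘ (pos 1) j →
          pos a ℤ.* pos (1 * suc j) ℤ.< (pos 4 ℤ.* pos (suc j) ℤ.+ -[1+ 0 ] ℤ.* pos 1) ℤ.* pos (suc b)
  cross (*<* p) = p

  lhs : pos a ℤ.* pos (1 * suc j) ℤ.+ pos (suc b) ≡ pos (suc j * a + suc b)
  lhs = cong (ℤ._+ pos (suc b)) (trans (≡-sym (ℤ.pos-* a (1 * suc j)))
          (cong pos (trans (*-comm a _) (cong (_* a) (*-identityˡ (suc j))))))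

  eq : ∀ x y → (pos 4 ℤ.* x ℤ.+ -[1+ 0 ] ℤ.* pos 1) ℤ.* y ℤ.+ y ≡ pos 4 ℤ.* x ℤ.* y
  eq = ℤ-Solver.solve-∀

  rhs : (pos 4 ℤ.* pos (suc j) ℤ.+ -[1+ 0 ] ℤ.* pos 1) ℤ.* pos (suc b) ℤ.+ pos (suc b) ≡ pos (4 * suc j * suc b)
  rhs = trans (eq (pos (suc j)) (pos (suc b)))
          (trans (cong (ℤ._* pos (suc b)) (≡-sym (ℤ.pos-* 4 (suc j)))) (≡-sym (ℤ.pos-* (4 * suc j) (suc b))))

-- This is average degree < 4 - 1/c multiplied by `c * countV S`, with the subtracted term moved to
-- the left.
Sparse : ∀ {n} → ℕ → Graph n → Set
Sparse c G = ∀ S → 0 < countV S → c * (2 * edgesIn G S) + countV S < 4 * c * countV S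

madLess⇒Sparse : ∀ {n} (G : Graph n) j → madLess G (fourMinusInv (suc j)) → Sparse (suc j) G
-- Abstracting `countV S` lets `avgDeg` reduce to its quotient.
madLess⇒Sparse G j mad S 0<S with countV S | 0<S | mad S 0<S
... | suc b | _ | lt = clear-denominators (2 * edgesIn G S) b j lt

deg≤Δ : ∀ {n} (G : Graph n) v → deg G v ≤ Δ G
deg≤Δ {n} G v = go (∈-allFin v)
  where
  go : ∀ {vs} → v ∈ vs → deg G v ≤ foldr _⊔_ 0 (map (deg G) vs)
  go (here refl)          = m≤m⊔n _ _
  go (there {x = u} v∈) = ≤-trans (go v∈) (m≤n⊔m (deg G u) _)

singleton-∈ : ∀ {A : Set} {xs : List A} → length xs ≡ 1 → ∀ {x y} → x ∈ xs → y ∈ xs → x ≡ y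
singleton-∈ {xs = _ ∷ []} _ (here refl) (here refl) = refl

-- Unavoidable configurations and the induction

module _ {n : ℕ} (k e : ℕ) where

  private
    c = 2 + k
    D = 21 + 14 * k + e

  Leaf : Graph n → Set
  Leaf G = ∃₂ λ v u → adj G v u ≡ true × deg G v ≡ 1

  LightEdge : Graph n → Set
  LightEdge G = ∃₂ λ u v → adj G u v ≡ true × nbrDegSum G u ≤ 2 * D × nbrDegSum G v < 2 * D

  -- Without a leaf or a light edge, `dense` applies. A single edge would then make the support a
  -- nonempty set that violates `Sparse`.
  unavoidable : (G : Graph n) → (∀ v → deg G v ≤ D) → Sparse c G →
                Leaf G ⊎ LightEdge G ⊎ (∀ u v → adj G u v ≢ true)
  unavoidable G deg≤D sparse
    with Fin.any? (λ v → Fin.any? λ u → (adj G v u Bool.≟ true) ×-dec (deg G v ℕ.≟ 1))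
       | Fin.any? (λ u → Fin.any? λ v → (adj G u v Bool.≟ true) ×-dec ((nbrDegSum G u ≤? 2 * D) ×-dec (nbrDegSum G v <? 2 * D)))
  ... | yes leaf | _          = inj₁ leaf
  ... | no _     | yes light  = inj₂ (inj₁ light)
  ... | no ¬leaf | no ¬light  = inj₂ (inj₂ λ u v uv → <-irrefl refl (contra uv))
    where
    open Discharging G k e
    N = countV (support G)
    E = edgesIn G (support G)

    no-leaf : ∀ v → deg G v ≢ 1
    no-leaf v dv≡1 with nbrs G v in eq | length-nbrs G v
    ... | []    | 0≡dv with () ← trans 0≡dv dv≡1
    ... | u ∷ _ | _ = ¬leaf (v , u , ∈-nbrs⁻ G (subst (u ∈_) (≡-sym eq) (here refl)) , dv≡1)

    irreducible : ∀ {u v} → adj G u v ≡ true → nbrDegSum G v < 2 * D → 2 * D < nbrDegSum G u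
    irreducible {u} {v} uv dv< = ≰⇒> λ du≤ → ¬light (u , v , uv , du≤ , dv<)

    eq₁ : ∀ k x → 2 * (4 * (2 + k) * x) ≡ 2 * x + (14 + 8 * k) * x
    eq₁ = solve-∀
    eq₂ : ∀ k x y → 2 * x + (4 + 2 * k) * y ≡ 2 * ((2 + k) * y + x)
    eq₂ = solve-∀

    -- Everything is doubled because `T` is 2(4c - 1).
    contra : ∀ {u v} → adj G u v ≡ true → 2 * (4 * c * N) < 2 * (4 * c * N)
    contra {u} {v} uv = begin-strict
      2 * (4 * c * N)                  ≡⟨ eq₁ k N ⟩
      2 * N + (14 + 8 * k) * N         ≤⟨ +-monoʳ-≤ (2 * N) (dense deg≤D no-leaf irreducible) ⟩
      2 * N + (4 + 2 * k) * (2 * E)    ≡⟨ eq₂ k N (2 * E) ⟩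
      2 * (c * (2 * E) + N)            <⟨ *-monoʳ-< 2 (sparse (support G) 0<N) ⟩
      2 * (4 * c * N)                  ∎
      where
      open ≤-Reasoning
      one : (if support G u then 1 else 0) ≡ 1
      one rewrite support-adj G uv = refl
      0<N : 0 < N
      0<N = ≤-trans (≤-reflexive (≡-sym one)) (term≤∑ (λ w → if support G w then 1 else 0) (∈-allFin u))

  module _ (L : Fin n → List ℕ) (L-ok : ∀ v → Unique (L v) × 2 * D ≤ length (L v)) where

    Colouring : Graph n → Set
    Colouring G = ∃ λ (φ : Fin n → ℕ) → (∀ v → φ v ∈ L v) × (∀ {a b} → Conflict G a b → φ a ≢ φ b)

    -- Deleting an edge lowers the degree sum, which `fuel` bounds. `D` stays fixed, since the
    -- maximum degree may drop; the bound `deg G v ≤ D` and `Sparse` both survive, as degrees and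
    -- edge counts do not grow.
    colour : ∀ fuel (G : Graph n) → ∑ (allFin n) (deg G) < fuel →
             (∀ v → deg G v ≤ D) → Sparse c G → Colouring G
    colour (suc fuel) G (s≤s size) deg≤D sparse = case unavoidable G deg≤D sparse of λ where
        (inj₁ (v , u , vu , dv≡1)) →
          let φ , φ∈L , φ-proper = smaller u v (adj-flip G vu)
          in extend-vertex G L L-ok φ∈L (leaf-light v dv≡1)
               λ a≢v b≢v ab → φ-proper (delete-leaf-conflict G u v (leaf-nbr vu dv≡1) a≢v b≢v ab)
        (inj₂ (inj₁ (u , v , uv , du≤ , dv<))) →
          let φ , φ∈L , φ-proper = smaller u v uv
          in extend-edge G L L-ok φ∈L uv du≤ dv<
               λ a≢ b≢ ab → φ-proper (delete-conflict G u v a≢ b≢ ab)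
        (inj₂ (inj₂ edgeless)) →
          proj₁ ∘ pick , proj₂ ∘ pick , λ ab → contradiction ab (no-conflict edgeless)
      where
      smaller : ∀ u v → adj G u v ≡ true → Colouring (delete G u v)
      smaller u v uv = colour fuel (delete G u v)
        (<-≤-trans (totalDeg-delete< G u v uv) size)
        (λ w → ≤-trans (deg-delete≤ G u v w) (deg≤D w))
        (λ S 0<S → ≤-<-trans (+-monoˡ-≤ (countV S) (*-monoʳ-≤ c (*-monoʳ-≤ 2 (edgesIn-delete≤ G u v S)))) (sparse S 0<S))

      no-conflict : (∀ u v → adj G u v ≢ true) → ∀ {a b} → ¬ Conflict G a b
      no-conflict edgeless (_ , inj₁ ab)           = edgeless _ _ ab
      no-conflict edgeless (_ , inj₂ (_ , aw , _)) = edgeless _ _ aw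

      pick : ∀ v → ∃ λ x → x ∈ L v
      pick v with L v | L-ok v
      ... | x ∷ _ | _ = x , here refl
      -- The list is nonempty because `2 * D` is positive.
      ... | []    | _ , ()

      leaf-nbr : ∀ {u v} → adj G v u ≡ true → deg G v ≡ 1 → ∀ {b} → adj G v b ≡ true → b ≡ u
      leaf-nbr {u} {v} vu dv≡1 vb =
        singleton-∈ (trans (length-nbrs G v) dv≡1) (∈-nbrs⁺ G vb) (∈-nbrs⁺ G vu)

      leaf-light : ∀ v → deg G v ≡ 1 → nbrDegSum G v < 2 * D
      leaf-light v dv≡1 = begin-strict
        nbrDegSum G v                  ≤⟨ ∑-mono (nbrs G v) (λ _ → deg≤D _) ⟩
        ∑ (nbrs G v) (λ _ → D)         ≡⟨ ∑-const (nbrs G v) D ⟩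
        length (nbrs G v) * D          ≡⟨ cong (_* D) (trans (length-nbrs G v) dv≡1) ⟩
        1 * D                          <⟨ *-monoˡ-< D {1} {2} (s≤s (s≤s z≤n)) ⟩
        2 * D                          ∎
        where open ≤-Reasoning

theorem1p4 : (c : ℕ) → 2 ≤ c → (n : ℕ) → (G : Graph n) →
    madLess G (fourMinusInv c) → 14 * c ∸ 7 ≤ Δ G →
    χℓSquare≤ G (2 * Δ G)
theorem1p4 (suc (suc k)) (s≤s (s≤s z≤n)) n G mad Δ≥ L L-ok =
  -- `≤-refl` sets the fuel to the degree sum plus one, and `Δ≡` identifies `Δ G` with the fixed
  -- bound `D`.
  let φ , φ∈L , φ-proper = colour k e L (λ v → subst (λ d → Unique (L v) × 2 * d ≤ length (L v)) Δ≡ (L-ok v)) _ G ≤-refl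
                             (λ v → subst (deg G v ≤_) Δ≡ (deg≤Δ G v)) (madLess⇒Sparse G (suc k) mad)
  in φ , φ∈L , λ u v uv → φ-proper (sqAdj⇒conflict G uv)
  where
  e = Δ G ∸ (14 * (2 + k) ∸ 7)

  eq : ∀ k → 14 * (2 + k) ≡ 7 + (21 + 14 * k)
  eq = solve-∀

  Δ≡ : Δ G ≡ 21 + 14 * k + e
  Δ≡ = trans (≡-sym (m+[n∸m]≡n Δ≥)) (cong (_+ e) (trans (cong (_∸ 7) (eq k)) (m+n∸m≡n 7 (21 + 14 * k))))
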